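{- For a positive integer $n \equiv 0 \pmod 5$ and $k \ge 2$, let $F_1, F_2, \ldots, F_k$ be graphs on a common set of $n$ vertices, each of which is isomorphic to the vertex-disjoint union of $n/5$ copies of the $5$-cycle $C_5$. Then $\gamma_{\rm sd}(F_1,F_2) \le 3n/5$, and this bound is sharp (that is, there exist a positive integer $n \equiv 0 \pmod 5$ and two such graphs $F_1,F_2$ on $n$ vertices with $\gamma_{\rm sd}(F_1,F_2) = 3n/5$). Further, for $k \ge 3$, \[ \gamma_{\rm sd}(F_1,F_2,\ldots,F_k) \le \left( \frac{3}{5} + \frac{2}{5} \left( 1 - \left( \frac{3}{5} \right)^{k-2} \right) \right) n. \]
   Context: All graphs are finite and simple. Given graphs $F_1,\ldots,F_k$ (called factors; not necessarily edge-disjoint) with common vertex set $V$, a set $S \subseteq V$ is a simultaneous dominating set if for every $i$, $1 \le i \le k$, every vertex not in $S$ is adjacent in $F_i$ to some vertex of $S$. The simultaneous domination number $\gamma_{\rm sd}(F_1,\ldots,F_k)$ is the minimum cardinality of a simultaneous dominating set. -}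

module Defs where

open import Data.Bool.Base using (true; false)
open import Data.Fin.Base using (Fin; toℕ)
open import Data.Fin.Properties as Fin using (all?; any?)
open import Data.Fin.Subset using (Subset; inside; outside; _∈_; _∉_; ⊤; ∣_∣)
open import Data.Fin.Subset.Properties using (_∈?_; ∈⊤)
open import Data.List.Base as List using (List; filter; _++_)
open import Data.List.Extrema.Nat using (argmin; argmin-all; f[argmin]≤f[xs])
open import Data.List.Membership.Propositional using () renaming (_∈_ to _∈ₗ_)
open import Data.List.Membership.Propositional.Properties using (∈-map⁺; ∈-++⁺ˡ; ∈-++⁺ʳ; ∈-filter⁺)
import Data.List.Relation.Unary.All as ListAll
open import Data.List.Relation.Unary.All.Properties using (all-filter)
open import Data.List.Relation.Unary.Any using (here)
open import Data.Nat.Base using (ℕ; zero; suc; _≤_)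
import Data.Nat.Properties as ℕ
open import Data.Nat.DivMod using (_/_; _%_)
open import Data.Product.Base using (_×_; _,_; ∃-syntax)
open import Data.Sum.Base as Sum using (_⊎_)
open import Data.Vec.Base using (Vec; []; _∷_)
import Data.Vec.Relation.Unary.All as VecAll
open import Data.Vec.Relation.Unary.All using (All)
open import Function.Bundles using (_↔_; _⇔_; Inverse)
open import Level using (0ℓ)
open import Relation.Binary.Core using (Rel)
open import Relation.Binary.Definitions using (Decidable; Symmetric; Irreflexive)
open import Relation.Binary.PropositionalEquality as ≡ using (_≡_; refl)
open import Relation.Nullary.Decidable using (Dec; ¬?; _×-dec_; _⊎-dec_; _→-dec_; from-yes)
open import Relation.Nullary.Negation using (contradiction)

record Graph (V : Set) : Set₁ where
  field
    Adj    : Rel V 0ℓ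
    adj?   : Decidable Adj
    sym    : Symmetric Adj
    irrefl : Irreflexive _≡_ Adj

open Graph

infix 4 _≅_

record _≅_ {V W : Set} (G : Graph V) (H : Graph W) : Set where
  field
    bijection : V ↔ W
    adjacency : ∀ u v → Adj G u v ⇔ Adj H (Inverse.to bijection u) (Inverse.to bijection v)

C₅ : Graph (Fin 5)
C₅ .Adj i j = toℕ j ≡ suc (toℕ i) % 5 ⊎ toℕ i ≡ suc (toℕ j) % 5
C₅ .adj? i j = (toℕ j ℕ.≟ suc (toℕ i) % 5) ⊎-dec (toℕ i ℕ.≟ suc (toℕ j) % 5)
C₅ .sym = Sum.swap
C₅ .irrefl {i} refl = from-yes (all? (λ v → ¬? (adj? C₅ v v))) i

copies : ∀ {V} (m : ℕ) → Graph V → Graph (Fin m × V)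
copies m G .Adj (i , u) (j , v) = i ≡ j × Adj G u v
copies m G .adj? (i , u) (j , v) = (i Fin.≟ j) ×-dec adj? G u v
copies m G .sym (i≡j , uv) = ≡.sym i≡j , sym G uv
copies m G .irrefl refl (_ , uu) = irrefl G refl uu

module _ {n : ℕ} where

  IsDisjointUnionOfC₅ : Graph (Fin n) → Set
  IsDisjointUnionOfC₅ G = G ≅ copies (n / 5) C₅

  Dominates : Subset n → Graph (Fin n) → Set
  Dominates S G = ∀ v → v ∉ S → ∃[ u ] u ∈ S × Adj G v u

  dominates? : Decidable Dominates
  dominates? S G =
    all? λ v → ¬? (v ∈? S) →-dec any? λ u → (u ∈? S) ×-dec adj? G v u

  SimultaneouslyDominates : ∀ {k} → Vec (Graph (Fin n)) k → Subset n → Set₁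
  SimultaneouslyDominates Fs S = All (Dominates S) Fs

  simultaneouslyDominates? : ∀ {k} (Fs : Vec (Graph (Fin n)) k) S →
                             Dec (SimultaneouslyDominates Fs S)
  simultaneouslyDominates? Fs S = VecAll.all? (dominates? S) Fs

subsets : ∀ n → List (Subset n)
subsets zero    = List.[ [] ]
subsets (suc n) = List.map (inside ∷_) (subsets n) ++ List.map (outside ∷_) (subsets n)

∈-subsets : ∀ {n} (S : Subset n) → S ∈ₗ subsets n
∈-subsets []            = here refl
∈-subsets (true ∷ S)    = ∈-++⁺ˡ (∈-map⁺ (inside ∷_) (∈-subsets S))
∈-subsets (false ∷ S)   = ∈-++⁺ʳ (List.map (inside ∷_) (subsets _)) (∈-map⁺ (outside ∷_) (∈-subsets S))

module _ {n k : ℕ} (Fs : Vec (Graph (Fin n)) k) where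

  -- The full vertex set serves as the default of `argmin`; it always
  -- dominates, so the default does not change the minimum.
  minimumSet : Subset n
  minimumSet = argmin ∣_∣ ⊤ (filter (simultaneouslyDominates? Fs) (subsets n))

  γsd : ℕ
  γsd = ∣ minimumSet ∣

  minimumSet-dominates : SimultaneouslyDominates Fs minimumSet
  minimumSet-dominates =
    argmin-all ∣_∣ (VecAll.universal (λ _ v v∉⊤ → contradiction ∈⊤ v∉⊤) Fs)
      (all-filter (simultaneouslyDominates? Fs) (subsets n))

  γsd-minimal : ∀ S → SimultaneouslyDominates Fs S → γsd ≤ ∣ S ∣
  γsd-minimal S dom =
    ListAll.lookup (f[argmin]≤f[xs] ⊤ (filter (simultaneouslyDominates? Fs) (subsets n)))
      (∈-filter⁺ (simultaneouslyDominates? Fs) (∈-subsets S) dom)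

-- The copies of C₅ in F₁ and F₂ are the two sides of a 5-regular bipartite multigraph
-- whose edges are the vertices of the graphs. By König's theorem its edges have a proper
-- colouring with 5 colours, and every colour class has at most n/5 elements. The union of three
-- classes meets every cycle in three vertices, and any three vertices of C₅ dominate it.
-- For each further factor, every subset B of C₅ extends to a dominating B′ that misses at
-- least 3/5 of the vertices missed by B.

module Submission where

open import Defs
open import Data.Bool.Base using (Bool; true; false; not; if_then_else_)
open import Data.Bool.Properties using (not-¬; not-involutive)
open import Data.Empty using (⊥; ⊥-elim)
open import Data.Fin.Base using (Fin; zero; suc; toℕ; fromℕ<; combine; _↑ˡ_; _↑ʳ_)
open import Data.Fin.Patterns using (0F; 3F; 4F)
open import Data.Fin.Properties as Fin using (injective⇒≤)
open import Data.Fin.Subset using (Subset; _∉_; _⊆_; ∣_∣) renaming (_∈_ to _∈ₛ_)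
open import Data.Fin.Subset.Properties using (_∈?_; _⊆?_; anySubset?)
open import Data.Integer.Base as ℤ using (+_)
import Data.Integer.Properties as ℤ
import Data.Integer.Tactic.RingSolver as ℤSolver
open import Data.List.Base using (List; []; _∷_; filter; length; allFin)
open import Data.List.Membership.Propositional using (_∈_; find; lose)
open import Data.List.Membership.Propositional.Properties using (∈-filter⁺; ∈-filter⁻; ∈-allFin)
open import Data.List.Properties using (filter-notAll)
open import Data.List.Relation.Unary.Any as Any using (here)
open import Data.Nat.Base as ℕ using (ℕ; _∸_)
open import Data.Nat.Divisibility using (_∣_; divides)
import Data.Nat.DivMod as ℕ
import Data.Nat.Properties as ℕ
open import Data.Nat.Tactic.RingSolver using (solve-∀)
open import Data.Product.Base using (_×_; _,_; proj₁; proj₂; ∃-syntax)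
open import Data.Rational.Base using (ℚ; _/_; _≤_; _+_; _*_; _-_; 1ℚ; +-*-rawSemiring; toℚᵘ; fromℚᵘ)
import Data.Rational.Properties as ℚ
open import Data.Rational.Solver using (module +-*-Solver)
open import Data.Rational.Unnormalised.Base as ℚᵘ using (mkℚᵘ)
import Data.Rational.Unnormalised.Properties as ℚᵘ
open import Data.Sum.Base using (_⊎_; inj₁; inj₂)
open import Data.Vec.Base as Vector using (Vec; []; _∷_)
open import Data.Vec.Properties using (lookup⇒[]=; []=⇒lookup; lookup∘tabulate; tabulate∘lookup; tabulate-cong)
open import Data.Vec.Relation.Unary.All as VecAll using (All; []; _∷_)
open import Algebra.Definitions.RawSemiring +-*-rawSemiring using (_^_)
open import Algebra.Properties.CommutativeMonoid.Sum ℕ.+-0-commutativeMonoid using (sum; sum-permute; sum-cong-≗)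
open import Function.Base using (_∘_; const)
open import Function.Bundles using (_↔_; Inverse; Equivalence; mk↔ₛ′)
open import Function.Definitions using (Injective)
open import Function.Construct.Identity using (⇔-id)
open import Function.Properties.Inverse using (↔-sym; ↔-trans)
open import Level using (0ℓ)
open import Relation.Binary.Definitions using (DecidableEquality)
open import Relation.Binary.PropositionalEquality
  using (_≡_; _≢_; refl; sym; trans; cong; cong₂; subst; subst₂; module ≡-Reasoning)
open import Relation.Nullary.Decidable
  using (Dec; yes; no; does; dec-true; from-yes; from-no; ¬?; _×-dec_; _⊎-dec_; _→-dec_; map′; decidable-stable)
open import Relation.Nullary.Negation using (¬_; contradiction)
open import Relation.Unary using (Pred; Decidable)

open Graph hiding (sym)

-- Edge colourings of bipartite multigraphs

-- Pigeonhole for two values, used both for the colours `α` and `β` being exchanged and for the two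
-- high colours on a 5-cycle.
two-values : ∀ {C : Set} {α β p q r : C} → (p ≡ α ⊎ p ≡ β) → (q ≡ α ⊎ q ≡ β) → (r ≡ α ⊎ r ≡ β) →
             p ≢ q → q ≢ r → p ≢ r → ⊥
two-values (inj₁ refl) (inj₁ refl) _           p≢q _   _   = p≢q refl
two-values (inj₁ refl) (inj₂ refl) (inj₁ refl) _   _   p≢r = p≢r refl
two-values (inj₁ refl) (inj₂ refl) (inj₂ refl) _   q≢r _   = q≢r refl
two-values (inj₂ refl) (inj₁ refl) (inj₁ refl) _   q≢r _   = q≢r refl
two-values (inj₂ refl) (inj₁ refl) (inj₂ refl) _   _   p≢r = p≢r refl
two-values (inj₂ refl) (inj₂ refl) _           p≢q _   _   = p≢q refl

-- A bipartite multigraph with edge set E is a pair of functions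
-- f : E → A and g : E → B giving the two ends of each edge.
module EdgeColouring {E : Set} (_≟_ : DecidableEquality E) where

  -- Properness on one side of the bipartition only; a proper edge colouring separates both `f` and
  -- `g`.
  Separates : {A C : Set} → (E → A) → (E → C) → List E → Set
  Separates f c xs = ∀ {x y} → x ∈ xs → y ∈ xs → x ≢ y → f x ≡ f y → c x ≢ c y

  AtMostTwo : {A : Set} → (E → A) → List E → Set
  AtMostTwo f xs = ∀ {x y z} → x ∈ xs → y ∈ xs → z ∈ xs → x ≢ y → y ≢ z → x ≢ z →
                   f x ≡ f y → f y ≡ f z → ⊥

  -- The degree bound is phrased as a ban on stars of `d + 1` edges, because such a star is what the
  -- absence of a free colour produces.
  AtMost : {A : Set} → ℕ → (E → A) → Set
  AtMost d f = ∀ (h : Fin (ℕ.suc d) → E) → Injective _≡_ _≡_ h → ¬ (∀ i → f (h i) ≡ f (h zero))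

  search? : {P : Pred E 0ℓ} → Decidable P → ∀ xs → Dec (∃[ z ] z ∈ xs × P z)
  search? P? xs = map′ find (λ (_ , z∈xs , Pz) → lose z∈xs Pz) (Any.any? P? xs)

  delete : E → List E → List E
  delete x = filter (λ z → ¬? (z ≟ x))

  ∈-delete⁺ : ∀ {x z xs} → z ∈ xs → z ≢ x → z ∈ delete x xs
  ∈-delete⁺ = ∈-filter⁺ (λ z → ¬? (z ≟ _))

  ∈-delete⁻ : ∀ {x z} xs → z ∈ delete x xs → z ∈ xs × z ≢ x
  ∈-delete⁻ xs = ∈-filter⁻ (λ z → ¬? (z ≟ _)) {xs = xs}

  delete-⊆ : ∀ {x z} xs → z ∈ delete x xs → z ∈ xs
  delete-⊆ xs = proj₁ ∘ ∈-delete⁻ xs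

  AtMostTwo-⊆ : ∀ {A : Set} {f : E → A} {xs ys} → (∀ {z} → z ∈ ys → z ∈ xs) → AtMostTwo f xs → AtMostTwo f ys
  AtMostTwo-⊆ ys⊆xs f≤2 x∈ y∈ z∈ = f≤2 (ys⊆xs x∈) (ys⊆xs y∈) (ys⊆xs z∈)

  length-delete : ∀ {x xs} → x ∈ xs → length (delete x xs) ℕ.< length xs
  length-delete x∈xs = filter-notAll _ _ (Any.map (λ x≡z z≢x → z≢x (sym x≡z)) x∈xs)

  module _ {C : Set} where

    _[_↦_] : (E → C) → E → C → E → C
    (c [ x ↦ v ]) z with z ≟ x
    ... | yes _ = v
    ... | no  _ = c z

    -- Only pairs containing `x` can become bad, and the freshness condition rules these out.
    extend : ∀ {A : Set} (f : E → A) {c x v} xs → Separates f c (delete x xs) →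
             (∀ {z} → z ∈ delete x xs → f z ≡ f x → c z ≢ v) → Separates f (c [ x ↦ v ]) xs
    extend f {c} {x} {v} xs sep fresh {y} {z} y∈ z∈ y≢z fy≡fz with y ≟ x | z ≟ x
    ... | yes refl | yes refl = contradiction refl y≢z
    ... | yes refl | no  z≢x  = fresh (∈-delete⁺ z∈ z≢x) (sym fy≡fz) ∘ sym
    ... | no  y≢x  | yes refl = fresh (∈-delete⁺ y∈ y≢x) fy≡fz
    ... | no  y≢x  | no  z≢x  = sep (∈-delete⁺ y∈ y≢x) (∈-delete⁺ z∈ z≢x) y≢z fy≡fz

  -- `x` and `y` may share an end: their opposite colours keep that pair proper.
  extend₂ : ∀ {A : Set} (f : E → A) {c x y v} xs → let zs = delete y (delete x xs) in Separates f c zs →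
            (∀ {z} → z ∈ zs → f z ≡ f x → c z ≢ v) → (∀ {z} → z ∈ zs → f z ≡ f y → c z ≢ not v) →
            Separates f ((c [ y ↦ not v ]) [ x ↦ v ]) xs
  extend₂ f {c} {x} {y} {v} xs sep x-ok y-ok = extend f xs (extend f (delete x xs) sep y-ok) fresh
    where
    fresh : ∀ {z} → z ∈ delete x xs → f z ≡ f x → (c [ y ↦ not v ]) z ≢ v
    fresh {z} z∈ fz with z ≟ y
    ... | yes refl = not-¬ refl ∘ sym
    ... | no  z≢y  = x-ok (∈-delete⁺ z∈ z≢y) fz

  Free : ∀ {A C : Set} → (E → A) → (E → C) → List E → E → C → Set
  Free h c ys e γ = ∀ {y} → y ∈ ys → y ≢ e → h y ≡ h e → c y ≢ γ

  used? : ∀ {A : Set} → DecidableEquality A → ∀ {d} (h : E → A) (c : E → Fin d) ys e γ →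
          Dec (∃[ y ] y ∈ ys × y ≢ e × h y ≡ h e × c y ≡ γ)
  used? _≟A_ h c ys e γ = search? (λ y → ¬? (y ≟ e) ×-dec (h y ≟A h e) ×-dec (c y Fin.≟ γ)) ys

  -- Otherwise `e` and one user of each of the `d` colours form a star of `d + 1` edges; the users
  -- are distinct because their colours are.
  free-colour : ∀ {A : Set} → DecidableEquality A → ∀ {d} (h : E → A) → AtMost d h →
                ∀ (c : E → Fin d) ys e → ∃[ γ ] Free h c ys e γ
  free-colour _≟A_ {d} h h≤d c ys e with Fin.any? (λ γ → ¬? (used? _≟A_ h c ys e γ))
  ... | yes (γ , ¬used) = γ , λ y∈ y≢e hy cy → ¬used (_ , y∈ , y≢e , hy , cy)
  ... | no  ¬free       = ⊥-elim (h≤d star star-injective same-end)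
    where
    user : ∀ γ → ∃[ y ] y ∈ ys × y ≢ e × h y ≡ h e × c y ≡ γ
    user γ = decidable-stable (used? _≟A_ h c ys e γ) (λ ¬used → ¬free (γ , ¬used))

    star : Fin (ℕ.suc d) → E
    star zero    = e
    star (suc γ) = proj₁ (user γ)

    star-injective : Injective _≡_ _≡_ star
    star-injective {zero}  {zero}  _  = refl
    star-injective {zero}  {suc γ} eq with _ , _ , y≢e , _ ← user γ = contradiction (sym eq) y≢e
    star-injective {suc γ} {zero}  eq with _ , _ , y≢e , _ ← user γ = contradiction eq y≢e
    star-injective {suc γ} {suc δ} eq with user γ | user δ
    ... | y , _ , _ , _ , refl | z , _ , _ , _ , refl = cong (suc ∘ c) eq

    same-end : ∀ i → h (star i) ≡ h e
    same-end zero    = refl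
    same-end (suc γ) with _ , _ , _ , hy , _ ← user γ = hy

  insert : ∀ {A C : Set} (h : E → A) {c : E → C} {ys e γ} → Separates h c ys → Free h c ys e γ →
           Separates h (c [ e ↦ γ ]) (e ∷ ys)
  insert h {ys = ys} {e = e} sep free = extend h (e ∷ ys)
    (λ x∈ y∈ → sep (in-ys x∈) (in-ys y∈))
    (λ z∈ → free (in-ys z∈) (proj₂ (∈-delete⁻ (e ∷ ys) z∈)))
    where
    in-ys : ∀ {z} → z ∈ delete e (e ∷ ys) → z ∈ ys
    in-ys z∈ with z∈′ , z≢e ← ∈-delete⁻ (e ∷ ys) z∈ = Any.tail z≢e z∈′

  module _ {A B : Set} (_≟A_ : DecidableEquality A) (_≟B_ : DecidableEquality B) where

    module Merge (g : E → B) (x y : E) where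

      merge : E → B
      merge z with g z ≟B g y
      ... | yes _ = g x
      ... | no  _ = g z

      merge-≡ : ∀ {u v} → g u ≡ g v → merge u ≡ merge v
      merge-≡ {u} {v} gu≡gv with g u ≟B g y | g v ≟B g y
      ... | yes _     | yes _     = refl
      ... | yes gu≡gy | no  gv≢gy = contradiction (trans (sym gu≡gv) gu≡gy) gv≢gy
      ... | no  gu≢gy | yes gv≡gy = contradiction (trans gu≡gv gv≡gy) gu≢gy
      ... | no  _     | no  _     = gu≡gv

      merge-identifies : ∀ {u v} → g u ≡ g x → g v ≡ g y → merge u ≡ merge v
      merge-identifies {u} {v} gu≡gx gv≡gy with g u ≟B g y | g v ≟B g y
      ... | _     | no  gv≢gy = contradiction gv≡gy gv≢gy
      ... | yes _ | yes _     = refl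
      ... | no  _ | yes _     = gu≡gx

      merge-⁻ : ∀ u v → merge u ≡ merge v →
                g u ≡ g v ⊎ (g u ≡ g x × g v ≡ g y) ⊎ (g u ≡ g y × g v ≡ g x)
      merge-⁻ u v eq with g u ≟B g y | g v ≟B g y
      ... | yes gu≡gy | yes gv≡gy = inj₁ (trans gu≡gy (sym gv≡gy))
      ... | yes gu≡gy | no  _     = inj₂ (inj₂ (gu≡gy , sym eq))
      ... | no  _     | yes gv≡gy = inj₂ (inj₁ (eq , gv≡gy))
      ... | no  _     | no  _     = inj₁ eq

      -- With `x` and `y` gone, each of the ends `g x` and `g y` retains at most one edge, so the
      -- merged end has degree at most two. Every case that involves a merged end yields three edges
      -- at one original end, with `x` or `y` among them.
      AtMostTwo-merge : ∀ xs → x ∈ xs → y ∈ xs → x ≢ y → AtMostTwo g xs →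
                        AtMostTwo merge (delete y (delete x xs))
      AtMostTwo-merge xs x∈ y∈ x≢y g≤2 {a} {b} {c} a∈′ b∈′ c∈′ a≢b b≢c a≢c a~b b~c
        with a∈″ , a≢y ← ∈-delete⁻ (delete x xs) a∈′ | b∈″ , b≢y ← ∈-delete⁻ (delete x xs) b∈′
           | c∈″ , c≢y ← ∈-delete⁻ (delete x xs) c∈′
        with a∈ , a≢x ← ∈-delete⁻ xs a∈″ | b∈ , b≢x ← ∈-delete⁻ xs b∈″ | c∈ , c≢x ← ∈-delete⁻ xs c∈″
        with merge-⁻ a b a~b | merge-⁻ b c b~c
      ... | inj₁ ab | inj₁ bc = g≤2 a∈ b∈ c∈ a≢b b≢c a≢c ab bc
      ... | inj₁ ab | inj₂ (inj₁ (bx , _)) = g≤2 a∈ b∈ x∈ a≢b b≢x a≢x ab bx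
      ... | inj₁ ab | inj₂ (inj₂ (by , _)) = g≤2 a∈ b∈ y∈ a≢b b≢y a≢y ab by
      ... | inj₂ (inj₁ (_ , by)) | inj₁ bc = g≤2 b∈ c∈ y∈ b≢c c≢y b≢y bc (trans (sym bc) by)
      ... | inj₂ (inj₂ (_ , bx)) | inj₁ bc = g≤2 b∈ c∈ x∈ b≢c c≢x b≢x bc (trans (sym bc) bx)
      -- Here `b` sits at both merged ends, so `g x ≡ g y` and `b`, `x`, `y` share one end.
      ... | inj₂ (inj₁ (_ , by)) | inj₂ (inj₁ (bx , _)) =
        g≤2 b∈ x∈ y∈ b≢x x≢y b≢y bx (trans (sym bx) by)
      ... | inj₂ (inj₂ (_ , bx)) | inj₂ (inj₂ (by , _)) =
        g≤2 b∈ x∈ y∈ b≢x x≢y b≢y bx (trans (sym bx) by)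
      ... | inj₂ (inj₁ (ax , _)) | inj₂ (inj₂ (_ , cx)) =
        g≤2 a∈ c∈ x∈ a≢c c≢x a≢x (trans ax (sym cx)) cx
      ... | inj₂ (inj₂ (ay , _)) | inj₂ (inj₁ (_ , cy)) =
        g≤2 a∈ c∈ y∈ a≢c c≢y a≢y (trans ay (sym cy)) cy

    -- At most one further edge remains at `g x` and one at `g y`. If both exist, they meet at the
    -- merged end and so differ in colour; hence the colours that avoid them at `x` and at `y` are
    -- opposite.
    merge-colours : ∀ (g : E → B) {x y} xs → x ∈ xs → y ∈ xs → x ≢ y → AtMostTwo g xs →
      let zs = delete y (delete x xs) in
      ∀ (c : E → Bool) → Separates (Merge.merge g x y) c zs →
      ∃[ v ] (∀ {z} → z ∈ zs → g z ≡ g x → c z ≢ v) × (∀ {z} → z ∈ zs → g z ≡ g y → c z ≢ not v)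
    merge-colours g {x} {y} xs x∈ y∈ x≢y g≤2 c sep = choose
      where
      open Merge g x y
      zs = delete y (delete x xs)

      ∈-zs : ∀ {z} → z ∈ zs → z ∈ xs × z ≢ x × z ≢ y
      ∈-zs z∈ with z∈′ , z≢y ← ∈-delete⁻ (delete x xs) z∈ with z∈″ , z≢x ← ∈-delete⁻ xs z∈′ = z∈″ , z≢x , z≢y

      unique : ∀ {w u v} → w ∈ xs → (∀ {z} → z ∈ zs → z ≢ w) → u ∈ zs → v ∈ zs →
               g u ≡ g w → g v ≡ g w → u ≡ v
      unique {w} {u} {v} w∈ ≢w u∈ v∈ gu gv with u ≟ v
      ... | yes u≡v = u≡v
      ... | no  u≢v = ⊥-elim (g≤2 (proj₁ (∈-zs u∈)) (proj₁ (∈-zs v∈)) w∈ u≢v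
                             (≢w v∈) (≢w u∈) (trans gu (sym gv)) gv)

      opposite : ∀ {u v} → u ∈ zs → v ∈ zs → g u ≡ g x → g v ≡ g y → c u ≢ c v
      opposite {u} {v} u∈ v∈ gu gv = sep u∈ v∈ u≢v (merge-identifies gu gv)
        where
        u≢v : u ≢ v
        u≢v refl with z∈ , z≢x , z≢y ← ∈-zs u∈ =
          g≤2 z∈ x∈ y∈ z≢x x≢y z≢y gu (trans (sym gu) gv)

      choose : ∃[ v ] (∀ {z} → z ∈ zs → g z ≡ g x → c z ≢ v) × (∀ {z} → z ∈ zs → g z ≡ g y → c z ≢ not v)
      choose with search? (λ z → g z ≟B g x) zs | search? (λ z → g z ≟B g y) zs
      ... | yes (u , u∈ , gu) | _ = not (c u) ,
        (λ z∈ gz → subst (λ w → c w ≢ not (c u)) (unique x∈ (proj₁ ∘ proj₂ ∘ ∈-zs) u∈ z∈ gu gz) (not-¬ refl)) ,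
        (λ z∈ gz cz≡ → opposite u∈ z∈ gu gz (sym (trans cz≡ (not-involutive (c u)))))
      ... | no ¬u | yes (u , u∈ , gu) = c u ,
        (λ z∈ gz → ⊥-elim (¬u (_ , z∈ , gz))) ,
        (λ z∈ gz → subst (λ w → c w ≢ not (c u)) (unique y∈ (proj₂ ∘ proj₂ ∘ ∈-zs) u∈ z∈ gu gz) (not-¬ refl))
      ... | no ¬u | no ¬v = true , (λ z∈ gz → ⊥-elim (¬u (_ , z∈ , gz))) , (λ z∈ gz → ⊥-elim (¬v (_ , z∈ , gz)))

    -- Serves an edge `x` with no partner at its end in `A`: only its end in `B` restricts the
    -- colour, and at most one other edge lies there.
    single-colour : ∀ (g : E → B) {x} xs → x ∈ xs → AtMostTwo g xs → ∀ (c : E → Bool) →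
                    ∃[ v ] (∀ {z} → z ∈ delete x xs → g z ≡ g x → c z ≢ v)
    single-colour g {x} xs x∈ g≤2 c with search? (λ z → g z ≟B g x) (delete x xs)
    ... | no  ¬u            = true , λ z∈ gz → ⊥-elim (¬u (_ , z∈ , gz))
    ... | yes (u , u∈′ , gu) = not (c u) , λ {z} z∈′ gz → avoid z∈′ gz
      where
      avoid : ∀ {z} → z ∈ delete x xs → g z ≡ g x → c z ≢ not (c u)
      avoid {z} z∈′ gz with u∈ , u≢x ← ∈-delete⁻ xs u∈′ | z∈ , z≢x ← ∈-delete⁻ xs z∈′ with z ≟ u
      ... | yes refl = not-¬ refl
      ... | no  z≢u  = ⊥-elim (g≤2 z∈ u∈ x∈ z≢u u≢x z≢x (trans gz (sym gu)) gu)

    -- Two edges x, y with a common end in A are removed together, and their ends in B are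
    -- merged: a proper colouring of the rest then extends to x and y.
    two-colourable : ∀ fuel (f : E → A) (g : E → B) xs → length xs ℕ.≤ fuel →
                     AtMostTwo f xs → AtMostTwo g xs →
                     ∃[ c ] Separates {C = Bool} f c xs × Separates g c xs
    two-colourable _ f g [] _ _ _ = const true , (λ ()) , (λ ())
    two-colourable (ℕ.suc fuel) f g xs@(x ∷ _) len≤ f≤2 g≤2
      with search? (λ z → ¬? (z ≟ x) ×-dec (f z ≟A f x)) xs
    ... | no ¬y
      with c , f-sep , g-sep ← two-colourable fuel f g (delete x xs)
             (ℕ.≤-pred (ℕ.≤-trans (length-delete {xs = xs} (here refl)) len≤))
             (AtMostTwo-⊆ (delete-⊆ xs) f≤2) (AtMostTwo-⊆ (delete-⊆ xs) g≤2)
      with v , g-ok ← single-colour g xs (here refl) g≤2 c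
      = c [ x ↦ v ]
      , extend f xs f-sep (λ z∈′ fz → let z∈ , z≢x = ∈-delete⁻ xs z∈′ in ⊥-elim (¬y (_ , z∈ , z≢x , fz)))
      , extend g xs g-sep g-ok
    ... | yes (y , y∈ , y≢x , fy≡fx)
      with c , f-sep , g-sep ← two-colourable fuel f (Merge.merge g x y) (delete y (delete x xs))
             (ℕ.≤-pred (ℕ.≤-trans (ℕ.<-trans (length-delete (∈-delete⁺ y∈ y≢x))
                                             (length-delete {xs = xs} (here refl))) len≤))
             (AtMostTwo-⊆ (delete-⊆ xs ∘ delete-⊆ (delete x xs)) f≤2)
             (Merge.AtMostTwo-merge g x y xs (here refl) y∈ (y≢x ∘ sym) g≤2)
      with v , x-ok , y-ok ← merge-colours g xs (here refl) y∈ (y≢x ∘ sym) g≤2 c g-sep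
      = (c [ y ↦ not v ]) [ x ↦ v ]
      , extend₂ f xs f-sep (λ z∈ fz → ⊥-elim (alone z∈ fz)) (λ z∈ fz → ⊥-elim (alone z∈ (trans fz fy≡fx)))
      , extend₂ g xs (λ a∈ b∈ a≢b → g-sep a∈ b∈ a≢b ∘ Merge.merge-≡ g x y) x-ok y-ok
      where
      -- `x` and `y` exhaust the degree two at their common end in `A`.
      alone : ∀ {z} → z ∈ delete y (delete x xs) → f z ≢ f x
      alone z∈″ fz with z∈′ , z≢y ← ∈-delete⁻ (delete x xs) z∈″ with z∈ , z≢x ← ∈-delete⁻ xs z∈′ =
        f≤2 z∈ y∈ (here refl) z≢y y≢x z≢x (trans fz (sym fy≡fx)) fy≡fx

  -- If α is free at one end of a new edge e and β at the other, then e and the edges coloured α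
  -- or β form a graph of maximum degree two, so they can be recoloured without tracing a Kempe chain.
  module Kempe {d : ℕ} (c : E → Fin d) (ys : List E) (e : E) (α β : Fin d) where

    Swapped : Pred E 0ℓ
    Swapped z = z ≡ e ⊎ c z ≡ α ⊎ c z ≡ β

    swapped? : Decidable Swapped
    swapped? z = (z ≟ e) ⊎-dec (c z Fin.≟ α) ⊎-dec (c z Fin.≟ β)

    W : List E
    W = filter swapped? (e ∷ ys)

    -- Giving `e` the colour `γ` free at its end keeps the colouring proper under `h`, and then all
    -- of `W` carries only `α` or `β`. The two sides use different choices: `α` for `f` and `β` for
    -- `g`.
    W-AtMostTwo : ∀ {A : Set} (h : E → A) γ → γ ≡ α ⊎ γ ≡ β → Separates h c ys → Free h c ys e γ →
                  AtMostTwo h W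
    W-AtMostTwo h γ γ-αβ sep free x∈ y∈ z∈ x≢y y≢z x≢z hx≡hy hy≡hz =
      two-values (values x∈) (values y∈) (values z∈)
        (sep′ (in-list x∈) (in-list y∈) x≢y hx≡hy)
        (sep′ (in-list y∈) (in-list z∈) y≢z hy≡hz)
        (sep′ (in-list x∈) (in-list z∈) x≢z (trans hx≡hy hy≡hz))
      where
      in-list : ∀ {z} → z ∈ W → z ∈ e ∷ ys
      in-list z∈ = proj₁ (∈-filter⁻ swapped? {xs = e ∷ ys} z∈)

      sep′ : Separates h (c [ e ↦ γ ]) (e ∷ ys)
      sep′ = insert h sep free

      values : ∀ {z} → z ∈ W → (c [ e ↦ γ ]) z ≡ α ⊎ (c [ e ↦ γ ]) z ≡ β
      values {z} z∈ with z ≟ e | proj₂ (∈-filter⁻ swapped? {xs = e ∷ ys} z∈)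
      ... | yes _   | _         = γ-αβ
      ... | no  z≢e | inj₁ z≡e  = contradiction z≡e z≢e
      ... | no  _   | inj₂ c-αβ = c-αβ

    recolour : (E → Bool) → E → Fin d
    recolour b z with swapped? z
    ... | yes _ = if b z then α else β
    ... | no  _ = c z

    if-αβ : ∀ b → (if b then α else β) ≡ α ⊎ (if b then α else β) ≡ β
    if-αβ true  = inj₁ refl
    if-αβ false = inj₂ refl

    if-injective : α ≢ β → ∀ b b′ → (if b then α else β) ≡ (if b′ then α else β) → b ≡ b′
    if-injective α≢β true  true  _  = refl
    if-injective α≢β true  false eq = contradiction eq α≢β
    if-injective α≢β false true  eq = contradiction (sym eq) α≢β
    if-injective α≢β false false _  = refl

    -- No conflict crosses between `Swapped` edges and the others, since the others avoid `α` and
    -- `β`. Within the first group `b` is proper, within the second `c`.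
    recolour-separates : α ≢ β → ∀ {A : Set} (h : E → A) (b : E → Bool) → Separates h c ys →
                         Separates h b W → Separates h (recolour b) (e ∷ ys)
    recolour-separates α≢β h b c-sep b-sep {x} {y} x∈ y∈ x≢y hx≡hy with swapped? x | swapped? y
    ... | yes sx | yes sy =
      b-sep (∈-filter⁺ swapped? x∈ sx) (∈-filter⁺ swapped? y∈ sy) x≢y hx≡hy ∘ if-injective α≢β (b x) (b y)
    ... | yes _  | no ¬sy = λ eq → ¬sy (inj₂ (subst (λ γ → γ ≡ α ⊎ γ ≡ β) eq (if-αβ (b x))))
    ... | no ¬sx | yes _  = λ eq → ¬sx (inj₂ (subst (λ γ → γ ≡ α ⊎ γ ≡ β) (sym eq) (if-αβ (b y))))
    ... | no ¬sx | no ¬sy = c-sep (Any.tail (¬sx ∘ inj₁) x∈) (Any.tail (¬sy ∘ inj₁) y∈) x≢y hx≡hy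

  -- Edges are inserted one at a time. The number of colours is a successor so that `zero` can serve
  -- as the default colour for the empty list.
  edge-colouring : ∀ {A B : Set} → DecidableEquality A → DecidableEquality B →
                   ∀ {d} (f : E → A) (g : E → B) → AtMost (ℕ.suc d) f → AtMost (ℕ.suc d) g → ∀ xs →
                   ∃[ c ] Separates {C = Fin (ℕ.suc d)} f c xs × Separates g c xs
  edge-colouring _≟A_ _≟B_ f g f≤d g≤d [] = const zero , (λ ()) , (λ ())
  edge-colouring _≟A_ _≟B_ f g f≤d g≤d (e ∷ ys)
    with c , f-sep , g-sep ← edge-colouring _≟A_ _≟B_ f g f≤d g≤d ys
    with α , α-free ← free-colour _≟A_ f f≤d c ys e | β , β-free ← free-colour _≟B_ g g≤d c ys e
    with α Fin.≟ β
  ... | yes refl = c [ e ↦ α ] , insert f f-sep α-free , insert g g-sep β-free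
  ... | no  α≢β
    with b , f-sep′ , g-sep′ ← (let open Kempe c ys e α β in
           two-colourable _≟A_ _≟B_ _ f g W ℕ.≤-refl
             (W-AtMostTwo f α (inj₁ refl) f-sep α-free) (W-AtMostTwo g β (inj₂ refl) g-sep β-free))
    = let open Kempe c ys e α β in
      recolour b , recolour-separates α≢β f b f-sep f-sep′ , recolour-separates α≢β g b g-sep g-sep′

-- Dominating sets of disjoint unions of 5-cycles

⟦_⟧ : ∀ {n} {P : Pred (Fin n) 0ℓ} → Decidable P → Subset n
⟦ P? ⟧ = Vector.tabulate (does ∘ P?)

∈-⟦⟧⁺ : ∀ {n} {P : Pred (Fin n) 0ℓ} (P? : Decidable P) {v} → P v → v ∈ₛ ⟦ P? ⟧
∈-⟦⟧⁺ P? {v} Pv =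
  lookup⇒[]= v _ (trans (lookup∘tabulate (does ∘ P?) v) (dec-true (P? v) Pv))

∈-⟦⟧⁻ : ∀ {n} {P : Pred (Fin n) 0ℓ} (P? : Decidable P) {v} → v ∈ₛ ⟦ P? ⟧ → P v
∈-⟦⟧⁻ P? {v} v∈ = does⁻ (P? v) (trans (sym (lookup∘tabulate (does ∘ P?) v)) ([]=⇒lookup v∈))
  where
  does⁻ : ∀ {P : Set} (P? : Dec P) → does P? ≡ true → P
  does⁻ (yes p) _ = p

members : ∀ {n} (S : Subset n) → ∃[ h ] Injective _≡_ _≡_ h × (∀ (i : Fin ∣ S ∣) → h i ∈ₛ S)
members [] = (λ ()) , (λ { {()} }) , λ ()
members (false ∷ S) with h , h-inj , h∈ ← members S = suc ∘ h , h-inj ∘ Fin.suc-injective , Vector.there ∘ h∈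
members (true ∷ S) with h , h-inj , h∈ ← members S = h′ , h′-inj , h′∈
  where
  h′ : Fin (ℕ.suc ∣ S ∣) → Fin _
  h′ zero    = zero
  h′ (suc i) = suc (h i)
  h′-inj : Injective _≡_ _≡_ h′
  h′-inj {zero}  {zero}  _  = refl
  h′-inj {suc i} {suc j} eq = cong suc (h-inj (Fin.suc-injective eq))
  h′∈ : ∀ i → h′ i ∈ₛ true ∷ S
  h′∈ zero    = Vector.here
  h′∈ (suc i) = Vector.there (h∈ i)

-- `φ` may depend on the membership proof, which lets the colour of a low vertex be read as an
-- element of `Fin 3`.
∣∣≤ : ∀ {n k} (S : Subset n) (φ : ∀ {v} → v ∈ₛ S → Fin k) →
      (∀ {u v} (u∈ : u ∈ₛ S) (v∈ : v ∈ₛ S) → φ u∈ ≡ φ v∈ → u ≡ v) → ∣ S ∣ ℕ.≤ k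
∣∣≤ S φ φ-inj with h , h-inj , h∈ ← members S =
  injective⇒≤ {f = λ i → φ (h∈ i)} (h-inj ∘ φ-inj (h∈ _) (h∈ _))

abstract
  C₅-neighbours : ∀ i → ∃[ j ] ∃[ k ] Adj C₅ i j × Adj C₅ i k × j ≢ k
  C₅-neighbours = from-yes (Fin.all? λ (i : Fin 5) → Fin.any? λ j → Fin.any? λ k →
    adj? C₅ i j ×-dec adj? C₅ i k ×-dec ¬? (j Fin.≟ k))

  high-colours : ∀ (i : Fin 5) → ¬ (toℕ i ℕ.< 3) → i ≡ 3F ⊎ i ≡ 4F
  high-colours = from-yes (Fin.all? λ (i : Fin 5) →
    ¬? (toℕ i ℕ.<? 3) →-dec ((i Fin.≟ 3F) ⊎-dec (i Fin.≟ 4F)))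

module C₅-Union {n m : ℕ} {G : Graph (Fin n)} (iso : G ≅ copies m C₅) where
  open _≅_ iso
  open Inverse bijection using (to; from; strictlyInverseˡ; strictlyInverseʳ)

  cycle : Fin n → Fin m
  cycle = proj₁ ∘ to

  position : Fin n → Fin 5
  position = proj₂ ∘ to

  vertex : Fin m → Fin 5 → Fin n
  vertex j i = from (j , i)

  cycle-vertex : ∀ j i → cycle (vertex j i) ≡ j
  cycle-vertex j i = cong proj₁ (strictlyInverseˡ (j , i))

  position-vertex : ∀ j i → position (vertex j i) ≡ i
  position-vertex j i = cong proj₂ (strictlyInverseˡ (j , i))

  coordinates-injective : ∀ {u v} → cycle u ≡ cycle v → position u ≡ position v → u ≡ v
  coordinates-injective {u} {v} cs ps =
    trans (sym (strictlyInverseʳ u)) (trans (cong₂ vertex cs ps) (strictlyInverseʳ v))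

  vertex-adjacent : ∀ v {i} → Adj C₅ (position v) i → Adj G v (vertex (cycle v) i)
  vertex-adjacent v {i} a = Equivalence.from (adjacency v _)
    (subst (Adj (copies m C₅) (to v)) (sym (strictlyInverseˡ _)) (refl , a))

  open EdgeColouring {Fin n} Fin._≟_ using (AtMost)

  -- Six vertices on one cycle would need six distinct positions in `Fin 5`.
  cycle-AtMost : AtMost 5 cycle
  cycle-AtMost h h-inj same = ℕ.1+n≰n (injective⇒≤ {f = position ∘ h}
    (λ {i} {j} eq → h-inj (coordinates-injective (trans (same i) (sym (same j))) eq)))

  neighbours : ∀ v → ∃[ u ] ∃[ w ] Adj G v u × Adj G v w ×
               cycle v ≡ cycle u × cycle u ≡ cycle w × v ≢ u × u ≢ w × v ≢ w
  neighbours v with j , k , v~j , v~k , j≢k ← C₅-neighbours (position v) =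
    vertex (cycle v) j , vertex (cycle v) k , vertex-adjacent v v~j , vertex-adjacent v v~k ,
    sym (cycle-vertex _ j) , trans (cycle-vertex _ j) (sym (cycle-vertex _ k)) ,
    (λ eq → irrefl G eq (vertex-adjacent v v~j)) ,
    (λ eq → j≢k (trans (sym (position-vertex _ j)) (trans (cong position eq) (position-vertex _ k)))) ,
    (λ eq → irrefl G eq (vertex-adjacent v v~k))

  -- A vertex and its two neighbours have three different colours, so one of them is low.
  module _ (c : Fin n → Fin 5) (sep : ∀ {u v} → u ≢ v → cycle u ≡ cycle v → c u ≢ c v) where

    low? : Decidable (λ v → toℕ (c v) ℕ.< 3)
    low? v = toℕ (c v) ℕ.<? 3

    low-dominates : Dominates ⟦ low? ⟧ G
    low-dominates v v∉ with u , w , v~u , v~w , vu , uw , v≢u , u≢w , v≢w ← neighbours v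
      with u ∈? ⟦ low? ⟧ | w ∈? ⟦ low? ⟧
    ... | yes u∈ | _      = u , u∈ , v~u
    ... | no  _  | yes w∈ = w , w∈ , v~w
    ... | no u∉  | no w∉  = ⊥-elim (two-values (high v∉) (high u∉) (high w∉)
                                      (sep v≢u vu) (sep u≢w uw) (sep v≢w (trans vu uw)))
      where
      high : ∀ {z} → z ∉ ⟦ low? ⟧ → c z ≡ 3F ⊎ c z ≡ 4F
      high {z} z∉ = high-colours (c z) (z∉ ∘ ∈-⟦⟧⁺ low?)

    -- Distinct vertices of one colour lie on different cycles, so a low vertex is determined by its
    -- cycle and its colour.
    ∣low∣≤ : ∣ ⟦ low? ⟧ ∣ ℕ.≤ m ℕ.* 3
    ∣low∣≤ = ∣∣≤ ⟦ low? ⟧ (λ {v} v∈ → combine (cycle v) (fromℕ< (∈-⟦⟧⁻ low? v∈))) inj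
      where
      inj : ∀ {u v} (u∈ : u ∈ₛ ⟦ low? ⟧) (v∈ : v ∈ₛ ⟦ low? ⟧) →
            combine (cycle u) (fromℕ< (∈-⟦⟧⁻ low? u∈)) ≡ combine (cycle v) (fromℕ< (∈-⟦⟧⁻ low? v∈)) → u ≡ v
      inj {u} {v} u∈ v∈ eq with cs , is ← Fin.combine-injective _ _ _ _ eq with u Fin.≟ v
      ... | yes u≡v = u≡v
      ... | no  u≢v = contradiction
        (Fin.toℕ-injective (Fin.fromℕ<-injective _ _ (∈-⟦⟧⁻ low? u∈) (∈-⟦⟧⁻ low? v∈) is)) (sep u≢v cs)

two-factors : ∀ {n m} {F G : Graph (Fin n)} → F ≅ copies m C₅ → G ≅ copies m C₅ →
              ∃[ S ] Dominates S F × Dominates S G × ∣ S ∣ ℕ.≤ m ℕ.* 3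
two-factors {n} isoF isoG =
  let c , sepF , sepG = edge-colouring Fin._≟_ Fin._≟_ F.cycle G.cycle F.cycle-AtMost G.cycle-AtMost (allFin n) in
  -- Being low depends on the colouring alone, so the same set dominates both factors; its size is
  -- counted along the cycles of `F`.
  _ , F.low-dominates c (sepF (∈-allFin _) (∈-allFin _)) , G.low-dominates c (sepG (∈-allFin _) (∈-allFin _)) ,
  F.∣low∣≤ c (sepF (∈-allFin _) (∈-allFin _))
  where
  module F = C₅-Union isoF
  module G = C₅-Union isoG
  open EdgeColouring {Fin n} Fin._≟_ using (edge-colouring)

-- Extending a set to dominate one more factor

sum-tabulate : ∀ {n} (t : Fin n → Bool) → ∣ Vector.tabulate t ∣ ≡ sum (λ v → if t v then 1 else 0)
sum-tabulate {ℕ.zero}  t = refl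
sum-tabulate {ℕ.suc n} t with t 0F
... | true  = cong ℕ.suc (sum-tabulate (t ∘ suc))
... | false = sum-tabulate (t ∘ suc)

sum-+ : ∀ m {k} (t : Fin (m ℕ.+ k) → ℕ) → sum t ≡ sum (λ i → t (i ↑ˡ k)) ℕ.+ sum (λ j → t (m ↑ʳ j))
sum-+ ℕ.zero    t = refl
sum-+ (ℕ.suc m) t = trans (cong (t 0F ℕ.+_) (sum-+ m (t ∘ suc))) (sym (ℕ.+-assoc (t 0F) _ _))

sum-combine : ∀ m k (t : Fin (m ℕ.* k) → ℕ) → sum t ≡ sum {m} (λ j → sum {k} (λ i → t (combine j i)))
sum-combine ℕ.zero    k t = refl
sum-combine (ℕ.suc m) k t =
  trans (sum-+ k t) (cong (sum (λ i → t (i ↑ˡ (m ℕ.* k))) ℕ.+_) (sum-combine m k (t ∘ (k ↑ʳ_))))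

-- Adds up the size condition of `Completion` over the `m` cycles.
sum-affine-≤ : ∀ m (a b : Fin m → ℕ) → (∀ j → 5 ℕ.* a j ℕ.≤ 10 ℕ.+ 3 ℕ.* b j) →
               5 ℕ.* sum a ℕ.≤ m ℕ.* 10 ℕ.+ 3 ℕ.* sum b
sum-affine-≤ ℕ.zero    a b a≤b = ℕ.≤-refl
sum-affine-≤ (ℕ.suc m) a b a≤b = begin
  5 ℕ.* (a 0F ℕ.+ sum (a ∘ suc))
    ≡⟨ ℕ.*-distribˡ-+ 5 (a 0F) _ ⟩
  5 ℕ.* a 0F ℕ.+ 5 ℕ.* sum (a ∘ suc)
    ≤⟨ ℕ.+-mono-≤ (a≤b 0F) (sum-affine-≤ m (a ∘ suc) (b ∘ suc) (a≤b ∘ suc)) ⟩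
  10 ℕ.+ 3 ℕ.* b 0F ℕ.+ (m ℕ.* 10 ℕ.+ 3 ℕ.* sum (b ∘ suc))
    ≡⟨ regroup (b 0F) m (sum (b ∘ suc)) ⟩
  ℕ.suc m ℕ.* 10 ℕ.+ 3 ℕ.* (b 0F ℕ.+ sum (b ∘ suc)) ∎
  where
  open ℕ.≤-Reasoning
  regroup : ∀ x m y → 10 ℕ.+ 3 ℕ.* x ℕ.+ (m ℕ.* 10 ℕ.+ 3 ℕ.* y) ≡ ℕ.suc m ℕ.* 10 ℕ.+ 3 ℕ.* (x ℕ.+ y)
  regroup = solve-∀

-- The size condition is 5 ∣∁ B′∣ ≥ 3 ∣∁ B∣ with the complements expanded.
Completion : Subset 5 → Subset 5 → Set
Completion B B′ = B ⊆ B′ × Dominates B′ C₅ × 5 ℕ.* ∣ B′ ∣ ℕ.≤ 10 ℕ.+ 3 ℕ.* ∣ B ∣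

abstract
  -- An empty or one-element `B` extends to two nonadjacent vertices, a pair to any three vertices
  -- containing it, and a larger `B` already dominates.
  complete : ∀ B → ∃[ B′ ] Completion B B′
  -- The search for a counterexample runs over all 32 subsets, so it evaluates while `B` is still a
  -- variable.
  complete B = decidable-stable (completable? B)
    (λ ¬completable → from-no (anySubset? (¬? ∘ completable?)) (B , ¬completable))
    where
    completable? : Decidable (λ B → ∃[ B′ ] Completion B B′)
    completable? B = anySubset? λ B′ →
      B ⊆? B′ ×-dec dominates? B′ C₅ ×-dec (5 ℕ.* ∣ B′ ∣ ℕ.≤? 10 ℕ.+ 3 ℕ.* ∣ B ∣)

module Extension {n m : ℕ} {G : Graph (Fin n)} (iso : G ≅ copies m C₅) where
  open C₅-Union iso
  open _≅_ iso using (bijection)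
  open Inverse bijection using (from)

  restrict : Subset n → Fin m → Subset 5
  restrict S j = Vector.tabulate (λ i → Vector.lookup S (vertex j i))

  assemble : (Fin m → Subset 5) → Subset n
  assemble B = Vector.tabulate (λ v → Vector.lookup (B (cycle v)) (position v))

  restrict-assemble : ∀ B j → restrict (assemble B) j ≡ B j
  restrict-assemble B j = trans (tabulate-cong λ i →
      trans (lookup∘tabulate (λ v → Vector.lookup (B (cycle v)) (position v)) (vertex j i))
        (cong₂ (Vector.lookup ∘ B) (cycle-vertex j i) (position-vertex j i)))
    (tabulate∘lookup (B j))

  ∈-assemble⁺ : ∀ B {v} → position v ∈ₛ B (cycle v) → v ∈ₛ assemble B
  ∈-assemble⁺ B {v} p∈ = lookup⇒[]= v _ (trans (lookup∘tabulate _ v) ([]=⇒lookup p∈))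

  ∈-restrict⁺ : ∀ S {v} → v ∈ₛ S → position v ∈ₛ restrict S (cycle v)
  ∈-restrict⁺ S {v} v∈ = lookup⇒[]= (position v) _ (trans
    (lookup∘tabulate (Vector.lookup S ∘ vertex (cycle v)) (position v))
    (trans (cong (Vector.lookup S) (coordinates-injective (cycle-vertex _ _) (position-vertex _ _)))
      ([]=⇒lookup v∈)))

  -- The cycles partition the vertices: `π` reindexes the count by cycle and position, and the
  -- resulting sum splits cycle by cycle.
  ∣∣-restrict : ∀ S → ∣ S ∣ ≡ sum (λ j → ∣ restrict S j ∣)
  ∣∣-restrict S = begin
    ∣ S ∣                                          ≡⟨ cong ∣_∣ (tabulate∘lookup S) ⟨
    ∣ Vector.tabulate (Vector.lookup S) ∣          ≡⟨ sum-tabulate (Vector.lookup S) ⟩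
    sum weight                                     ≡⟨ sum-permute weight π ⟩
    sum (weight ∘ Inverse.to π)                    ≡⟨ sum-combine m 5 _ ⟩
    sum {m} (λ j → sum {5} (λ i → weight (Inverse.to π (combine {m} {5} j i))))
      ≡⟨ sum-cong-≗ (λ j → sum-cong-≗ (λ i → cong (weight ∘ from) (Fin.remQuot-combine j i))) ⟩
    sum (λ j → sum (λ i → weight (vertex j i)))
      ≡⟨ sum-cong-≗ (λ j → sum-tabulate (Vector.lookup S ∘ vertex j)) ⟨
    sum (λ j → ∣ restrict S j ∣)                   ∎
    where
    open ≡-Reasoning
    weight : Fin n → ℕ
    weight v = if Vector.lookup S v then 1 else 0
    π : Fin (m ℕ.* 5) ↔ Fin n
    π = ↔-trans Fin.*↔× (↔-sym bijection)

  -- Each cycle is completed on its own. As there are `5 m` vertices in all, the size bound says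
  -- that at least 3/5 of the vertices outside `S` stay outside `S′`.
  extension : ∀ S → ∃[ S′ ] S ⊆ S′ × Dominates S′ G × 5 ℕ.* ∣ S′ ∣ ℕ.≤ m ℕ.* 10 ℕ.+ 3 ℕ.* ∣ S ∣
  extension S = assemble B , ∈-assemble⁺ B ∘ proj₁ (completed _) ∘ ∈-restrict⁺ S , dominates , size
    where
    B : Fin m → Subset 5
    B j = proj₁ (complete (restrict S j))
    completed : ∀ j → Completion (restrict S j) (B j)
    completed j = proj₂ (complete (restrict S j))

    dominates : Dominates (assemble B) G
    dominates v v∉ with i , i∈ , v~i ← proj₁ (proj₂ (completed (cycle v))) (position v) (v∉ ∘ ∈-assemble⁺ B) =
      vertex (cycle v) i ,
      ∈-assemble⁺ B (subst₂ (λ j k → k ∈ₛ B j) (sym (cycle-vertex _ i)) (sym (position-vertex _ i)) i∈) ,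
      vertex-adjacent v v~i

    size : 5 ℕ.* ∣ assemble B ∣ ℕ.≤ m ℕ.* 10 ℕ.+ 3 ℕ.* ∣ S ∣
    size rewrite ∣∣-restrict S | ∣∣-restrict (assemble B) =
      sum-affine-≤ m _ _ λ j →
        subst (λ x → 5 ℕ.* ∣ x ∣ ℕ.≤ 10 ℕ.+ 3 ℕ.* ∣ restrict S j ∣) (sym (restrict-assemble B j))
          (proj₂ (proj₂ (completed j)))

Dominates-⊆ : ∀ {n} {S S′ : Subset n} → S ⊆ S′ → ∀ {G} → Dominates S G → Dominates S′ G
Dominates-⊆ S⊆S′ dom v v∉ with u , u∈ , v~u ← dom v (v∉ ∘ S⊆S′) = u , S⊆S′ u∈ , v~u

-- Arithmetic of the bound

fromℚᵘ-mono-≤ : ∀ {p q} → p ℚᵘ.≤ q → fromℚᵘ p ≤ fromℚᵘ q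
fromℚᵘ-mono-≤ {p} {q} p≤q = ℚ.toℚᵘ-cancel-≤
  (ℚᵘ.≤-respˡ-≃ (ℚᵘ.≃-sym (ℚ.toℚᵘ-fromℚᵘ p)) (ℚᵘ.≤-respʳ-≃ (ℚᵘ.≃-sym (ℚ.toℚᵘ-fromℚᵘ q)) p≤q))

/1-mono-≤ : ∀ x y → x ℕ.≤ y → + x / 1 ≤ + y / 1
-- `mkℚᵘ` stores the denominator minus one: 0 stands for 1 here, and 4 stands for 5 further on.
/1-mono-≤ x y x≤y = fromℚᵘ-mono-≤ {mkℚᵘ (+ x) 0} {mkℚᵘ (+ y) 0}
  (ℚᵘ.*≤* (ℤ.*-monoʳ-≤-nonNeg (+ 1) (ℤ.+≤+ x≤y)))

/5-upper : ∀ x y → 5 ℕ.* x ℕ.≤ y → + x / 1 ≤ + y / 5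
/5-upper x y 5x≤y = fromℚᵘ-mono-≤ {mkℚᵘ (+ x) 0} {mkℚᵘ (+ y) 4}
  (ℚᵘ.*≤* (subst₂ ℤ._≤_ (trans (cong +_ (ℕ.*-comm 5 x)) (ℤ.pos-* x 5))
    (sym (ℤ.*-identityʳ (+ y))) (ℤ.+≤+ 5x≤y)))

/5-affine : ∀ n s → + (2 ℕ.* n ℕ.+ 3 ℕ.* s) / 5 ≡ + 2 / 5 * (+ n / 1) + + 3 / 5 * (+ s / 1)
/5-affine n s = ℚ.toℚᵘ-injective (begin
  toℚᵘ (+ (2 ℕ.* n ℕ.+ 3 ℕ.* s) / 5)
    ≈⟨ ℚ.toℚᵘ-fromℚᵘ (mkℚᵘ (+ (2 ℕ.* n ℕ.+ 3 ℕ.* s)) 4) ⟩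
  mkℚᵘ (+ (2 ℕ.* n ℕ.+ 3 ℕ.* s)) 4
    -- Unnormalised addition gives the right-hand side the denominator 5 · 5, so
    -- cross-multiplication puts 25 on the left and 5 on the right.
    ≈⟨ ℚᵘ.*≡* (trans (cong (λ x → x ℤ.* + 25) cast) (regroup (+ n) (+ s))) ⟩
  mkℚᵘ (+ 2) 4 ℚᵘ.* mkℚᵘ (+ n) 0 ℚᵘ.+ mkℚᵘ (+ 3) 4 ℚᵘ.* mkℚᵘ (+ s) 0
    ≈⟨ ℚᵘ.+-cong (product (+ 2 / 5) n) (product (+ 3 / 5) s) ⟨
  toℚᵘ (+ 2 / 5 * (+ n / 1)) ℚᵘ.+ toℚᵘ (+ 3 / 5 * (+ s / 1))
    ≈⟨ ℚ.toℚᵘ-homo-+ (+ 2 / 5 * (+ n / 1)) (+ 3 / 5 * (+ s / 1)) ⟨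
  toℚᵘ (+ 2 / 5 * (+ n / 1) + + 3 / 5 * (+ s / 1)) ∎)
  where
  open ℚᵘ.≃-Reasoning
  product : ∀ p x → toℚᵘ (p * (+ x / 1)) ℚᵘ.≃ toℚᵘ p ℚᵘ.* mkℚᵘ (+ x) 0
  product p x = ℚᵘ.≃-trans (ℚ.toℚᵘ-homo-* p (+ x / 1)) (ℚᵘ.*-congˡ {toℚᵘ p} (ℚ.toℚᵘ-fromℚᵘ (mkℚᵘ (+ x) 0)))
  cast : + (2 ℕ.* n ℕ.+ 3 ℕ.* s) ≡ + 2 ℤ.* + n ℤ.+ + 3 ℤ.* + s
  cast = trans (ℤ.pos-+ (2 ℕ.* n) (3 ℕ.* s)) (cong₂ ℤ._+_ (ℤ.pos-* 2 n) (ℤ.pos-* 3 s))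
  regroup : ∀ n s → (+ 2 ℤ.* n ℤ.+ + 3 ℤ.* s) ℤ.* + 25 ≡ (+ 2 ℤ.* n ℤ.* + 5 ℤ.+ + 3 ℤ.* s ℤ.* + 5) ℤ.* + 5
  regroup = ℤSolver.solve-∀

-- `j` counts the factors beyond the first two. The value equals n - (2/5)(3/5)^j n: each further
-- factor multiplies the guaranteed number of unchosen vertices by 3/5.
bound : ℕ → ℕ → ℚ
bound n j = (+ 3 / 5 + + 2 / 5 * (1ℚ - (+ 3 / 5) ^ j)) * (+ n / 1)

bound-zero : ∀ n → + (3 ℕ.* n) / 5 ≡ bound n 0
bound-zero n = trans (/5-affine 0 n) (ℚ.+-identityˡ (+ 3 / 5 * (+ n / 1)))

-- Replacing the power by a variable `x` turns the recurrence for `bound` into a polynomial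
-- identity.
regroup-bound : ∀ N x → + 2 / 5 * N + + 3 / 5 * ((+ 3 / 5 + + 2 / 5 * (1ℚ - x)) * N) ≡
                (+ 3 / 5 + + 2 / 5 * (1ℚ - + 3 / 5 * x)) * N
regroup-bound = solve 2
  (λ N x → con (+ 2 / 5) :* N :+ con (+ 3 / 5) :* ((con (+ 3 / 5) :+ con (+ 2 / 5) :* (con 1ℚ :- x)) :* N)
        := (con (+ 3 / 5) :+ con (+ 2 / 5) :* (con 1ℚ :- con (+ 3 / 5) :* x)) :* N)
  refl
  where open +-*-Solver

bound-suc : ∀ n j → + 2 / 5 * (+ n / 1) + + 3 / 5 * bound n j ≡ bound n (ℕ.suc j)
bound-suc n j = regroup-bound (+ n / 1) ((+ 3 / 5) ^ j)

bound-base : ∀ n s → 5 ℕ.* s ℕ.≤ 3 ℕ.* n → + s / 1 ≤ bound n 0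
bound-base n s 5s≤3n = ℚ.≤-trans (/5-upper s (3 ℕ.* n) 5s≤3n) (ℚ.≤-reflexive (bound-zero n))

bound-step : ∀ n j s s′ → + s / 1 ≤ bound n j → 5 ℕ.* s′ ℕ.≤ 2 ℕ.* n ℕ.+ 3 ℕ.* s →
             + s′ / 1 ≤ bound n (ℕ.suc j)
bound-step n j s s′ s≤ s′≤ = begin
  + s′ / 1                                     ≤⟨ /5-upper s′ (2 ℕ.* n ℕ.+ 3 ℕ.* s) s′≤ ⟩
  + (2 ℕ.* n ℕ.+ 3 ℕ.* s) / 5                  ≡⟨ /5-affine n s ⟩
  + 2 / 5 * (+ n / 1) + + 3 / 5 * (+ s / 1)
    ≤⟨ ℚ.+-monoʳ-≤ (+ 2 / 5 * (+ n / 1)) (ℚ.*-monoˡ-≤-nonNeg (+ 3 / 5) s≤) ⟩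
  + 2 / 5 * (+ n / 1) + + 3 / 5 * bound n j    ≡⟨ bound-suc n j ⟩
  bound n (ℕ.suc j)                            ∎
  where open ℚ.≤-Reasoning

-- Assembling the upper bounds

module _ {n : ℕ} (5∣n : 5 ∣ n) where

  two-factors-≤ : ∀ {F G : Graph (Fin n)} → IsDisjointUnionOfC₅ F → IsDisjointUnionOfC₅ G →
                  ∃[ S ] SimultaneouslyDominates (F ∷ G ∷ []) S × 5 ℕ.* ∣ S ∣ ℕ.≤ 3 ℕ.* n
  two-factors-≤ isoF isoG = let S , domF , domG , S≤ = two-factors isoF isoG in
    S , domF ∷ domG ∷ [] , (begin
      5 ℕ.* ∣ S ∣              ≤⟨ ℕ.*-monoʳ-≤ 5 S≤ ⟩
      5 ℕ.* (n ℕ./ 5 ℕ.* 3)    ≡⟨ regroup (n ℕ./ 5) ⟩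
      3 ℕ.* (n ℕ./ 5 ℕ.* 5)    ≡⟨ cong (3 ℕ.*_) (ℕ.m/n*n≡m 5∣n) ⟩
      3 ℕ.* n                  ∎)
    where
    open ℕ.≤-Reasoning
    regroup : ∀ m → 5 ℕ.* (m ℕ.* 3) ≡ 3 ℕ.* (m ℕ.* 5)
    regroup = solve-∀

  extension-≤ : ∀ {k} {F : Graph (Fin n)} {Fs : Vec (Graph (Fin n)) k} → IsDisjointUnionOfC₅ F →
                ∀ S → SimultaneouslyDominates Fs S →
                ∃[ S′ ] SimultaneouslyDominates (F ∷ Fs) S′ × 5 ℕ.* ∣ S′ ∣ ℕ.≤ 2 ℕ.* n ℕ.+ 3 ℕ.* ∣ S ∣
  extension-≤ iso S dom = let S′ , S⊆S′ , dom′ , S′≤ = Extension.extension iso S in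
    S′ , dom′ ∷ VecAll.map (λ {G} → Dominates-⊆ S⊆S′ {G}) dom , (begin
      5 ℕ.* ∣ S′ ∣                              ≤⟨ S′≤ ⟩
      n ℕ./ 5 ℕ.* 10 ℕ.+ 3 ℕ.* ∣ S ∣            ≡⟨ regroup (n ℕ./ 5) ∣ S ∣ ⟩
      2 ℕ.* (n ℕ./ 5 ℕ.* 5) ℕ.+ 3 ℕ.* ∣ S ∣     ≡⟨ cong (λ x → 2 ℕ.* x ℕ.+ 3 ℕ.* ∣ S ∣) (ℕ.m/n*n≡m 5∣n) ⟩
      2 ℕ.* n ℕ.+ 3 ℕ.* ∣ S ∣                   ∎)
    where
    open ℕ.≤-Reasoning
    regroup : ∀ m x → m ℕ.* 10 ℕ.+ 3 ℕ.* x ≡ 2 ℕ.* (m ℕ.* 5) ℕ.+ 3 ℕ.* x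
    regroup = solve-∀

  -- The vector is peeled from the front, so its last two factors form the base case and each
  -- earlier one costs one extension.
  factors-≤ : ∀ j (Fs : Vec (Graph (Fin n)) (2 ℕ.+ j)) → All IsDisjointUnionOfC₅ Fs →
              ∃[ S ] SimultaneouslyDominates Fs S × + ∣ S ∣ / 1 ≤ bound n j
  factors-≤ ℕ.zero (F ∷ G ∷ []) (isoF ∷ isoG ∷ []) =
    let S , dom , S≤ = two-factors-≤ isoF isoG in
    S , dom , bound-base n ∣ S ∣ S≤
  factors-≤ (ℕ.suc j) (F ∷ Fs) (iso ∷ isos) =
    let S , dom , S≤ = factors-≤ j Fs isos
        S′ , dom′ , S′≤ = extension-≤ iso S dom
    in S′ , dom′ , bound-step n j ∣ S ∣ ∣ S′ ∣ S≤ S′≤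

γsd-≤ : ∀ {n k} (Fs : Vec (Graph (Fin n)) k) {q} →
        (∃[ S ] SimultaneouslyDominates Fs S × + ∣ S ∣ / 1 ≤ q) → + γsd Fs / 1 ≤ q
γsd-≤ Fs (S , dom , S≤) = ℚ.≤-trans (/1-mono-≤ (γsd Fs) ∣ S ∣ (γsd-minimal Fs S dom)) S≤

-- Sharpness: a pair of vertices dominates C₅ only if it is not an edge, so no pair dominates
-- both C₅ and its complement, the pentagram.

relabel : ∀ {V W} → V ↔ W → Graph W → Graph V
relabel π G .Adj u v = Adj G (Inverse.to π u) (Inverse.to π v)
relabel π G .adj? u v = adj? G (Inverse.to π u) (Inverse.to π v)
relabel π G .Graph.sym = Graph.sym G
relabel π G .irrefl refl = irrefl G refl

relabel-≅ : ∀ {V W} (π : V ↔ W) (G : Graph W) → relabel π G ≅ G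
relabel-≅ π G = record { bijection = π ; adjacency = λ _ _ → ⇔-id _ }

one-copy : Fin 5 ↔ (Fin 1 × Fin 5)
one-copy = Fin.*↔×

-- Doubling modulo 5 turns the differences ±2 of the pentagram into the differences ±1 of the
-- pentagon; its inverse is multiplication by 3, as 2 · 3 is 1 modulo 5.
doubling : Fin 5 ↔ Fin 5
doubling = mk↔ₛ′ (λ i → 2 ⊗ i) (λ i → 3 ⊗ i)
  (from-yes (Fin.all? λ i → 2 ⊗ (3 ⊗ i) Fin.≟ i)) (from-yes (Fin.all? λ i → 3 ⊗ (2 ⊗ i) Fin.≟ i))
  where
  _⊗_ : ℕ → Fin 5 → Fin 5
  k ⊗ i = fromℕ< (ℕ.m%n<n (k ℕ.* toℕ i) 5)

pentagon pentagram : Graph (Fin 5)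
pentagon  = relabel one-copy (copies 1 C₅)
pentagram = relabel (↔-trans doubling one-copy) (copies 1 C₅)

γsd-pentagon-pentagram : γsd (pentagon ∷ pentagram ∷ []) ≡ 3
-- `γsd` evaluates by filtering all 32 subsets and taking a smallest dominating one.
γsd-pentagon-pentagram = refl

theorem26 : (∀ (n : ℕ) → 0 ℕ.< n → 5 ∣ n →
    ∀ (F₁ F₂ : Graph (Fin n)) → IsDisjointUnionOfC₅ F₁ → IsDisjointUnionOfC₅ F₂ →
    + γsd (F₁ ∷ F₂ ∷ []) / 1 ≤ + (3 ℕ.* n) / 5)
    × (∃[ n ] 0 ℕ.< n × 5 ∣ n ×
    (∃[ F₁ ] ∃[ F₂ ] IsDisjointUnionOfC₅ {n} F₁ × IsDisjointUnionOfC₅ {n} F₂ ×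
    + γsd (F₁ ∷ F₂ ∷ []) / 1 ≡ + (3 ℕ.* n) / 5))
    × (∀ (n : ℕ) → 0 ℕ.< n → 5 ∣ n →
    ∀ (k : ℕ) → 3 ℕ.≤ k →
    ∀ (Fs : Vec (Graph (Fin n)) k) → All IsDisjointUnionOfC₅ Fs →
    + γsd Fs / 1 ≤ (+ 3 / 5 + + 2 / 5 * (1ℚ - (+ 3 / 5) ^ (k ∸ 2))) * (+ n / 1))
theorem26 =
  (λ _ _ 5∣n F₁ F₂ iso₁ iso₂ → let S , dom , S≤ = two-factors-≤ 5∣n iso₁ iso₂ in
    γsd-≤ (F₁ ∷ F₂ ∷ []) (S , dom , /5-upper ∣ S ∣ _ S≤)) ,
  (5 , ℕ.z<s , divides 1 refl , pentagon , pentagram ,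
    relabel-≅ one-copy (copies 1 C₅) , relabel-≅ (↔-trans doubling one-copy) (copies 1 C₅) ,
    -- `+ 3 / 1` and `+ 15 / 5` normalise to the same rational.
    cong (λ x → + x / 1) γsd-pentagon-pentagram) ,
  -- Writing `k` as `j + 2` makes `k ∸ 2` reduce to `j`, so the goal is `bound n j` unfolded.
  λ { _ _ 5∣n (ℕ.suc (ℕ.suc j)) _ Fs isos → γsd-≤ Fs (factors-≤ 5∣n j Fs isos)
    ; _ _ _ 1 (ℕ.s≤s ()) _ _ }
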